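{- Let $G$ be a distance-hereditary split graph and let $\mathcal{A}$ be the antimatroid whose basic words are the elimination orderings of $G$. Then either $\mathcal{A}$ contains two indistinguishable elements, or at least half of the vertices of $G$ are simplicial. In either case, $\mathcal{A}$ is balanced.
   Context: A split graph is a graph whose vertex set can be partitioned into a clique and an independent set. A graph is distance-hereditary if for any two vertices all induced paths between them have the same length. A vertex is simplicial if its neighbors form a clique. An elimination ordering is a total ordering of the vertices such that for each vertex $v$, the neighbors of $v$ occurring later than $v$ form a clique; the elimination orderings of a chordal graph (split graphs are chordal) form the basic words of an antimatroid $\mathcal{A}$ on the vertex set. Two elements $x,y$ are indistinguishable if swapping $x$ and $y$ in any basic word always produces another basic word. For vertices $x\ne y$, $\Pr[x<y]$ is the probability $x$ precedes $y$ in a uniformly random basic word; $\mathcal{A}$ is balanced if it has a pair with $\frac13\le\Pr[x<y]\le\frac23$ or has exactly one basic word. -}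

module Defs where

open import Data.Nat using (ℕ; zero; suc; _≤_; _<_; _*_)
open import Data.Fin using (Fin; toℕ; fromℕ; _≟_) renaming (zero to fz)
open import Data.Bool using (Bool; true; false; T; if_then_else_)
open import Data.List using (List; []; _∷_; [_]; length; filter; concatMap; map)
open import Data.List.Base using (allFin)
open import Data.List.Membership.Propositional using (_∈_)
import Data.List.Membership.DecPropositional as DecMem
open import Data.List.Relation.Unary.All using (All; all?)
open import Data.List.Relation.Unary.Unique.Propositional using (Unique)
open import Data.List.Relation.Binary.Permutation.Propositional using (_↭_)
open import Data.Product using (Σ; _×_; _,_; ∃; ∃-syntax)
open import Data.Sum using (_⊎_)
open import Data.Empty using (⊥)
open import Data.Unit using (⊤; tt)
open import Relation.Nullary using (¬_; Dec; yes; no; does)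
open import Relation.Nullary.Decidable using (_×-dec_; _⊎-dec_; T?)
open import Relation.Binary.PropositionalEquality using (_≡_; _≢_)

record Graph (n : ℕ) : Set where
  field
    adj   : Fin n → Fin n → Bool
    sym   : ∀ u v → adj u v ≡ adj v u
    irrfl : ∀ v → adj v v ≡ false

open Graph public

insertions : {A : Set} → A → List A → List (List A)
insertions x []       = [ x ∷ [] ]
insertions x (y ∷ ys) = (x ∷ y ∷ ys) ∷ map (y ∷_) (insertions x ys)

permutations : {A : Set} → List A → List (List A)
permutations []       = [ [] ]
permutations (x ∷ xs) = concatMap (insertions x) (permutations xs)

module _ {n : ℕ} where
  open DecMem (_≟_ {n}) using (_∈?_)

  Precedes : Fin n → Fin n → List (Fin n) → Set
  Precedes x y []      = ⊥
  Precedes x y (v ∷ r) = (v ≡ x × y ∈ r) ⊎ Precedes x y r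

  Precedes? : ∀ x y w → Dec (Precedes x y w)
  Precedes? x y []      = no (λ ())
  Precedes? x y (v ∷ r) = ((v ≟ x) ×-dec (y ∈? r)) ⊎-dec Precedes? x y r

  swapV : Fin n → Fin n → Fin n → Fin n
  swapV x y v = if does (v ≟ x) then y else (if does (v ≟ y) then x else v)

  swapWord : Fin n → Fin n → List (Fin n) → List (Fin n)
  swapWord x y = map (swapV x y)

module _ {n : ℕ} (G : Graph n) where

  E : Fin n → Fin n → Set
  E u v = T (adj G u v)

  E? : ∀ u v → Dec (E u v)
  E? u v = T? (adj G u v)

  IsSplit : Set
  IsSplit = Σ (Fin n → Bool) λ K →
      (∀ u v → u ≢ v → K u ≡ true  → K v ≡ true  → E u v)
    × (∀ u v →         K u ≡ false → K v ≡ false → ¬ E u v)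

  IsInducedPath : (u v : Fin n) (k : ℕ) → (Fin (suc k) → Fin n) → Set
  IsInducedPath u v k p =
      p fz ≡ u
    × p (fromℕ k) ≡ v
    × (∀ i j → p i ≡ p j → i ≡ j)
    × (∀ i j → suc (toℕ i) ≡ toℕ j → E (p i) (p j))
    × (∀ i j → suc (toℕ i) < toℕ j → ¬ E (p i) (p j))

  IsDistanceHereditary : Set
  IsDistanceHereditary = ∀ u v k l
    (p : Fin (suc k) → Fin n) (q : Fin (suc l) → Fin n) →
    IsInducedPath u v k p → IsInducedPath u v l q → k ≡ l

  IsSimplicial : Fin n → Set
  IsSimplicial v = ∀ a b → E v a → E v b → a ≢ b → E a b

  IsCliqueList : List (Fin n) → Set
  IsCliqueList l = All (λ a → All (λ b → a ≡ b ⊎ E a b) l) l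

  IsCliqueList? : ∀ l → Dec (IsCliqueList l)
  IsCliqueList? l = all? (λ a → all? (λ b → (a ≟ b) ⊎-dec E? a b) l) l

  ElimCondition : List (Fin n) → Set
  ElimCondition []      = ⊤
  ElimCondition (v ∷ r) = IsCliqueList (filter (E? v) r) × ElimCondition r

  ElimCondition? : ∀ w → Dec (ElimCondition w)
  ElimCondition? []      = yes tt
  ElimCondition? (v ∷ r) = IsCliqueList? (filter (E? v) r) ×-dec ElimCondition? r

  -- an elimination ordering = a total ordering of all vertices
  -- (a permutation of the vertex list) satisfying the condition;
  -- these are the basic words of the antimatroid A(G)
  IsBasicWord : List (Fin n) → Set
  IsBasicWord w = (w ↭ allFin n) × ElimCondition w

  -- the list of all basic words (each exactly once)
  basicWords : List (List (Fin n))
  basicWords = filter ElimCondition? (permutations (allFin n))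

  numBasicWords : ℕ
  numBasicWords = length basicWords

  numPrecedes : Fin n → Fin n → ℕ
  numPrecedes x y = length (filter (Precedes? x y) basicWords)

  Indistinguishable : Fin n → Fin n → Set
  Indistinguishable x y =
    ∀ w → IsBasicWord w → IsBasicWord (swapWord x y w)

  HasIndistinguishablePair : Set
  HasIndistinguishablePair = ∃[ x ] ∃[ y ] (x ≢ y × Indistinguishable x y)

  HalfSimplicial : Set
  HalfSimplicial = ∃[ S ] (Unique S × All IsSimplicial S × n ≤ 2 * length S)

  -- balanced: exactly one basic word, or a pair x ≠ y with
  -- 1/3 ≤ Pr[x < y] ≤ 2/3, where Pr[x < y] = numPrecedes x y / numBasicWords
  IsBalanced : Set
  IsBalanced = numBasicWords ≡ 1
    ⊎ ∃[ x ] ∃[ y ] (x ≢ y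
        × numBasicWords ≤ 3 * numPrecedes x y
        × 3 * numPrecedes x y ≤ 2 * numBasicWords)

{-# OPTIONS --safe #-}
module Submission where

-- An ordering is an elimination ordering iff no induced path a – v – b has its centre v first, so
-- relabelling words by an automorphism of G preserves them, and exchanging twins shows that twins
-- are indistinguishable and precede each other with probability 1/2.
--
-- Let G be twin-free, with clique K and independent set I.  A gem contains induced paths of lengths
-- 2 and 3 with the same ends, so the neighbourhoods of the vertices of I form a laminar family.
-- Sending a clique vertex to its I-neighbour of least degree is injective, since two clique
-- vertices with the same image are twins; this gives the bound on simplicial vertices.
--
-- For balance, take j in I of least degree among those with at least two neighbours.  The vertices
-- of N(j) differ only in whether they have a pendant neighbour.  If two do, exchanging them along
-- with their pendants is an automorphism; two that do not are twins.  Otherwise N(j) = {k , l}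
-- where only k has a pendant i, and explicit relabellings of i, j, k, l compare the words with
-- i < j to those with j < i.  If no such j exists, K plays the role of N(j).

open import Defs
open import Data.Bool using (Bool; true; false; T)
import Data.Bool.Properties as Bool
open import Data.Empty using (⊥; ⊥-elim)
open import Data.Fin using (Fin; toℕ; zero; suc; _≟_)
open import Data.Fin.Permutation using (Permutation′; permutation; _⟨$⟩ʳ_; _⟨$⟩ˡ_; inverseˡ; inverseʳ; _∘ₚ_)
open import Data.Fin.Properties using (any?; all?)
open import Data.List using (List; []; _∷_; _++_; length; filter; concatMap; map)
open import Data.List.Base using (allFin)
open import Data.List.Properties using (length-++; length-map; map-∘; map-cong; map-id; ∷-injectiveˡ; ∷-injectiveʳ; length-tabulate)
open import Data.List.Membership.Propositional using (_∈_; _∉_; find; lose)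
open import Data.List.Membership.Propositional.Properties using (∈-∃++; ∈-map⁺; ∈-map⁻; ∈-++⁺ˡ; ∈-++⁺ʳ; ∈-++⁻; ∈-concatMap⁺; ∈-concatMap⁻; ∈-filter⁺; ∈-filter⁻; ∈-allFin)
open import Data.List.Membership.Propositional.Properties.WithK using (unique∧set⇒bag)
open import Data.List.Relation.Binary.BagAndSetEquality using (∼bag⇒↭)
open import Data.List.Relation.Binary.Permutation.Propositional using (_↭_; ↭-sym; ↭-trans; ↭-reflexive; ↭⇒↭ₛ; prep)
open import Data.List.Relation.Binary.Permutation.Propositional.Properties using (∈-resp-↭; ↭-length; shift; drop-mid; ↭-empty-inv; map⁺)
open import Data.List.Relation.Binary.Permutation.Setoid.Properties using (Unique-resp-↭)
open import Data.List.Relation.Binary.Subset.Propositional using (_⊆_)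
open import Data.List.Relation.Unary.All using ([]; _∷_)
import Data.List.Relation.Unary.All as All
open import Data.List.Relation.Unary.AllPairs using ([]; _∷_)
open import Data.List.Relation.Unary.Any using (here; there)
open import Data.List.Relation.Unary.Unique.Propositional using (Unique)
import Data.List.Relation.Unary.Unique.Propositional.Properties as Unique
open import Data.Nat using (ℕ; zero; suc; _+_; _*_; _≤_; _<_; z≤n; s≤s; _<?_)
open import Data.Nat.Induction using (<-wellFounded)
open import Data.Nat.Properties using (≤-trans; ≤-antisym; *-distribˡ-+; +-monoˡ-≤; +-monoʳ-≤; +-comm; +-identityʳ; <-irrefl; ≮⇒≥; module ≤-Reasoning)
open import Data.Product using (_×_; _,_; ∃; ∃-syntax; proj₁; proj₂; uncurry)
open import Data.Sum using (_⊎_; inj₁; inj₂; [_,_]′)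
import Data.Sum as Sum
open import Function using (_∘_; id; mk⇔)
open import Induction.WellFounded using (Acc; acc)
open import Relation.Binary.PropositionalEquality using (_≡_; _≢_; refl; cong; subst; subst₂; trans; setoid) renaming (sym to ≡-sym)
open import Relation.Nullary using (¬_; Dec; yes; no; contradiction)
open import Relation.Nullary.Decidable using (¬?; _×-dec_; _→-dec_; _⊎-dec_; decidable-stable)

-- Enumerating the permutations of a list

concatMap-unique : ∀ {A B : Set} (f : A → List B) {xs} → Unique xs →
  (∀ {x} → x ∈ xs → Unique (f x)) →
  (∀ {x y b} → x ∈ xs → y ∈ xs → b ∈ f x → b ∈ f y → x ≡ y) →
  Unique (concatMap f xs)
concatMap-unique f [] _ _ = []
concatMap-unique f {x ∷ xs} (x∉xs ∷ uxs) uf inj =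
  Unique.++⁺ (uf (here refl))
    (concatMap-unique f uxs (uf ∘ there) λ y∈ z∈ → inj (there y∈) (there z∈))
    disjoint
  where
  disjoint : ∀ {b} → ¬ (b ∈ f x × b ∈ concatMap f xs)
  disjoint (b∈fx , b∈) with find (∈-concatMap⁻ f {xs = xs} b∈)
  ... | y , y∈xs , b∈fy = All.lookup x∉xs y∈xs (inj (here refl) (there y∈xs) b∈fx b∈fy)

-- Pigeonhole: the image `y` of the head is deleted from `ys`, and injectivity keeps the images of
-- the tail in what remains. A relation replaces a function because an image may be available only
-- for members of `xs`.
length-mono-injective : ∀ {A B : Set} {R : A → B → Set} {xs ys} → Unique xs →
  (∀ {x} → x ∈ xs → ∃[ y ] (y ∈ ys × R x y)) → (∀ {x x′ y} → R x y → R x′ y → x ≡ x′) →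
  length xs ≤ length ys
length-mono-injective [] _ _ = z≤n
length-mono-injective {R = R} {x ∷ xs} (x∉xs ∷ uxs) image inj with image (here refl)
... | y , y∈ , Rxy with ∈-∃++ y∈
...   | as , bs , refl =
  subst (suc (length xs) ≤_) (≡-sym (↭-length (shift y as bs)))
    (s≤s (length-mono-injective uxs (λ z∈xs → others z∈xs (image (there z∈xs))) inj))
  where
  others : ∀ {z} → z ∈ xs → ∃[ y′ ] (y′ ∈ as ++ y ∷ bs × R z y′) → ∃[ y′ ] (y′ ∈ as ++ bs × R z y′)
  others z∈xs (y′ , y′∈ , Rzy′) with ∈-resp-↭ (shift y as bs) y′∈
  ... | here refl = contradiction (inj Rxy Rzy′) (All.lookup x∉xs z∈xs)
  ... | there y′∈′ = y′ , y′∈′ , Rzy′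

module _ {A : Set} where

  length-mono-⊆ : {xs ys : List A} → Unique xs → xs ⊆ ys → length xs ≤ length ys
  length-mono-⊆ uxs xs⊆ys = length-mono-injective {R = _≡_} uxs
    (λ x∈ → _ , xs⊆ys x∈ , refl) (λ x≡y x′≡y → trans x≡y (≡-sym x′≡y))

  ∈-insertions⁺ : ∀ {x : A} as bs → as ++ x ∷ bs ∈ insertions x (as ++ bs)
  ∈-insertions⁺ []       []       = here refl
  ∈-insertions⁺ []       (_ ∷ _)  = here refl
  ∈-insertions⁺ (a ∷ as) bs       = there (∈-map⁺ (a ∷_) (∈-insertions⁺ as bs))

  ∈-insertions⁻ : ∀ {x : A} ys {w} → w ∈ insertions x ys →
    ∃[ as ] ∃[ bs ] (ys ≡ as ++ bs × w ≡ as ++ x ∷ bs)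
  ∈-insertions⁻ []       (here refl) = [] , [] , refl , refl
  ∈-insertions⁻ (y ∷ ys) (here refl) = [] , y ∷ ys , refl , refl
  ∈-insertions⁻ (y ∷ ys) (there w∈) with ∈-map⁻ (y ∷_) w∈
  ... | _ , w′∈ , refl with ∈-insertions⁻ ys w′∈
  ... | as , bs , refl , refl = y ∷ as , bs , refl , refl

  insertions-unique : ∀ {x : A} ys → x ∉ ys → Unique (insertions x ys)
  insertions-unique []       _   = [] ∷ []
  insertions-unique (y ∷ ys) x∉ =
    All.tabulate distinct ∷ Unique.map⁺ ∷-injectiveʳ (insertions-unique ys (x∉ ∘ there))
    where
    distinct : ∀ {w} → w ∈ map (y ∷_) (insertions _ ys) → _ ∷ y ∷ ys ≢ w
    distinct w∈ refl with ∈-map⁻ (y ∷_) w∈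
    ... | _ , _ , eq = x∉ (here (∷-injectiveˡ eq))

  -- Both sides contain `x` exactly once, so the two splits occur at the same place. Hence a word
  -- determines the list that `x` was inserted into, which keeps the blocks of `permutations`
  -- disjoint.
  deletion-unique : ∀ {x : A} as {bs} cs {ds} → x ∉ as ++ bs → x ∉ cs ++ ds →
    as ++ x ∷ bs ≡ cs ++ x ∷ ds → as ++ bs ≡ cs ++ ds
  deletion-unique []       []       _  _  refl = refl
  deletion-unique []       (_ ∷ _)  _  x∉ eq = contradiction (here (∷-injectiveˡ eq)) x∉
  deletion-unique (_ ∷ _)  []       x∉ _  eq = contradiction (here (≡-sym (∷-injectiveˡ eq))) x∉
  deletion-unique (a ∷ as) (c ∷ cs) x∉ x∉′ eq with ∷-injectiveˡ eq
  ... | refl = cong (a ∷_) (deletion-unique as cs (x∉ ∘ there) (x∉′ ∘ there) (∷-injectiveʳ eq))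

  ∈-permutations⁺ : ∀ {w} (xs : List A) → w ↭ xs → w ∈ permutations xs
  ∈-permutations⁺ []       p with ↭-empty-inv p
  ... | refl = here refl
  ∈-permutations⁺ (x ∷ xs) p with ∈-∃++ (∈-resp-↭ (↭-sym p) (here refl))
  ... | as , bs , refl =
    ∈-concatMap⁺ (insertions x)
      (lose (∈-permutations⁺ xs (drop-mid as [] p)) (∈-insertions⁺ as bs))

  ∈-permutations⁻ : ∀ {w} (xs : List A) → w ∈ permutations xs → w ↭ xs
  ∈-permutations⁻ []       (here refl) = ↭-reflexive refl
  ∈-permutations⁻ (x ∷ xs) w∈
    with find (∈-concatMap⁻ (insertions x) {xs = permutations xs} w∈)
  ... | ys , ys∈ , w∈ins with ∈-insertions⁻ ys w∈ins
  ... | as , bs , refl , refl = ↭-trans (shift x as bs) (prep x (∈-permutations⁻ xs ys∈))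

  -- Probabilities are ratios of list lengths, so a repetition in the enumeration would distort the
  -- counts.
  permutations-unique : ∀ {xs : List A} → Unique xs → Unique (permutations xs)
  permutations-unique [] = [] ∷ []
  permutations-unique {x ∷ xs} (x∉xs ∷ uxs) =
    concatMap-unique (insertions x) (permutations-unique uxs)
      (λ {ys} ys∈ → insertions-unique ys (x∉ ys∈)) same
    where
    x∉ : ∀ {ys} → ys ∈ permutations xs → x ∉ ys
    x∉ ys∈ x∈ys = All.lookup x∉xs (∈-resp-↭ (∈-permutations⁻ xs ys∈) x∈ys) refl
    same : ∀ {ys zs w} → ys ∈ permutations xs → zs ∈ permutations xs →
      w ∈ insertions x ys → w ∈ insertions x zs → ys ≡ zs
    same {ys} {zs} ys∈ zs∈ w∈ys w∈zs with ∈-insertions⁻ ys w∈ys | ∈-insertions⁻ zs w∈zs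
    ... | as , bs , refl , refl | cs , ds , refl , eq = deletion-unique as cs (x∉ ys∈) (x∉ zs∈) eq

-- The order in which a word lists its letters

module _ {n : ℕ} where

  precedes-∈ˡ : ∀ {x y : Fin n} w → Precedes x y w → x ∈ w
  precedes-∈ˡ (_ ∷ _) (inj₁ (refl , _)) = here refl
  precedes-∈ˡ (_ ∷ w) (inj₂ p)          = there (precedes-∈ˡ w p)

  precedes-∈ʳ : ∀ {x y : Fin n} w → Precedes x y w → y ∈ w
  precedes-∈ʳ (_ ∷ _) (inj₁ (_ , y∈)) = there y∈
  precedes-∈ʳ (_ ∷ w) (inj₂ p)        = there (precedes-∈ʳ w p)

  -- Repeated letters would break this: in the word y z x y, x precedes y and y precedes z, but x
  -- does not precede z.
  precedes-trans : ∀ {x y z : Fin n} {w} → Unique w →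
    Precedes x y w → Precedes y z w → Precedes x z w
  precedes-trans {w = _ ∷ w} (v∉ ∷ _) (inj₁ (_ , y∈)) (inj₁ (refl , _)) =
    contradiction refl (All.lookup v∉ y∈)
  precedes-trans {w = _ ∷ w} _        (inj₁ (refl , _)) (inj₂ q) = inj₁ (refl , precedes-∈ʳ w q)
  precedes-trans {w = _ ∷ w} (v∉ ∷ _) (inj₂ p) (inj₁ (refl , _)) =
    contradiction refl (All.lookup v∉ (precedes-∈ʳ w p))
  precedes-trans {w = _ ∷ w} (_ ∷ u)  (inj₂ p) (inj₂ q) = inj₂ (precedes-trans u p q)

  precedes-irrefl : ∀ {x : Fin n} {w} → Unique w → ¬ Precedes x x w
  precedes-irrefl {w = _ ∷ _} (v∉ ∷ _) (inj₁ (refl , x∈)) = contradiction refl (All.lookup v∉ x∈)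
  precedes-irrefl {w = _ ∷ _} (_ ∷ u)  (inj₂ p)           = precedes-irrefl u p

  precedes-total : ∀ {x y : Fin n} {w} → x ≢ y → x ∈ w → y ∈ w →
    Precedes x y w ⊎ Precedes y x w
  precedes-total x≢y (here refl) (here refl) = contradiction refl x≢y
  precedes-total x≢y (here refl) (there y∈)  = inj₁ (inj₁ (refl , y∈))
  precedes-total x≢y (there x∈)  (here refl) = inj₂ (inj₁ (refl , x∈))
  precedes-total x≢y (there x∈)  (there y∈)  = Sum.map inj₂ inj₂ (precedes-total x≢y x∈ y∈)

  precedes-map : ∀ (f : Fin n → Fin n) {x y} w → Precedes x y w → Precedes (f x) (f y) (map f w)
  precedes-map f (_ ∷ _) (inj₁ (refl , y∈)) = inj₁ (refl , ∈-map⁺ f y∈)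
  precedes-map f (_ ∷ w) (inj₂ p)           = inj₂ (precedes-map f w p)

  ordering-unique : ∀ {w} → w ↭ allFin n → Unique w
  ordering-unique p = Unique-resp-↭ (setoid _) (↭⇒↭ₛ (↭-sym p)) (Unique.allFin⁺ n)

  ordering-complete : ∀ {w} → w ↭ allFin n → ∀ x → x ∈ w
  ordering-complete p x = ∈-resp-↭ (↭-sym p) (∈-allFin x)

  map-cancel : (π : Permutation′ n) → ∀ w → map (π ⟨$⟩ˡ_) (map (π ⟨$⟩ʳ_) w) ≡ w
  map-cancel π w = trans (≡-sym (map-∘ w)) (trans (map-cong (λ _ → inverseˡ π) w) (map-id w))

  -- Two duplicate-free lists with the same members are equal as bags, hence permutations of one
  -- another.
  map-ordering : (π : Permutation′ n) → ∀ {w} → w ↭ allFin n → map (π ⟨$⟩ʳ_) w ↭ allFin n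
  map-ordering π p = ↭-trans (map⁺ (π ⟨$⟩ʳ_) p)
    (∼bag⇒↭ (unique∧set⇒bag (Unique.map⁺ injective (Unique.allFin⁺ n)) (Unique.allFin⁺ n)
      (λ {x} → mk⇔ (λ _ → ∈-allFin _)
        (λ _ → subst (_∈ _) (inverseʳ π) (∈-map⁺ (π ⟨$⟩ʳ_) (∈-allFin (π ⟨$⟩ˡ x)))))))
    where
    injective : ∀ {x y} → π ⟨$⟩ʳ x ≡ π ⟨$⟩ʳ y → x ≡ y
    injective eq = trans (≡-sym (inverseˡ π)) (trans (cong (π ⟨$⟩ˡ_) eq) (inverseˡ π))

  precedes-relabel : (π : Permutation′ n) → ∀ {x y} w →
    Precedes x y (map (π ⟨$⟩ʳ_) w) → Precedes (π ⟨$⟩ˡ x) (π ⟨$⟩ˡ y) w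
  precedes-relabel π w p =
    subst (Precedes _ _) (map-cancel π w) (precedes-map (π ⟨$⟩ˡ_) (map (π ⟨$⟩ʳ_) w) p)

  swapV-left : ∀ (x y : Fin n) → swapV x y x ≡ y
  swapV-left x y with x ≟ x
  ... | yes _  = refl
  ... | no x≢x = contradiction refl x≢x

  swapV-right : ∀ (x y : Fin n) → swapV x y y ≡ x
  swapV-right x y with y ≟ x
  ... | yes eq = eq
  ... | no _ with y ≟ y
  ...   | yes _  = refl
  ...   | no y≢y = contradiction refl y≢y

  swapV-other : ∀ {x y v : Fin n} → v ≢ x → v ≢ y → swapV x y v ≡ v
  swapV-other {x} {y} {v} v≢x v≢y with v ≟ x
  ... | yes eq = contradiction eq v≢x
  ... | no _ with v ≟ y
  ...   | yes eq = contradiction eq v≢y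
  ...   | no _   = refl

  swapV-involutive : ∀ (x y v : Fin n) → swapV x y (swapV x y v) ≡ v
  swapV-involutive x y v with v ≟ x
  ... | yes refl = swapV-right x y
  ... | no v≢x with v ≟ y
  ...   | yes refl = swapV-left x y
  ...   | no v≢y   = swapV-other v≢x v≢y

  swapₚ : Fin n → Fin n → Permutation′ n
  swapₚ x y = permutation (swapV x y) (swapV x y) (swapV-involutive x y) (swapV-involutive x y)

-- Elimination orderings and balanced pairs

module _ {n : ℕ} (G : Graph n) where

  E-sym : ∀ {u v} → E G u v → E G v u
  E-sym {u} {v} = subst T (sym G u v)

  E⇒≢ : ∀ {u v} → E G u v → u ≢ v
  E⇒≢ {u} e refl = subst T (irrfl G u) e

  -- Formulated for an arbitrary relation so that a relabelled word can be tested through the order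
  -- of the original one.
  NoPathCentreFirst : (Fin n → Fin n → Set) → Set
  NoPathCentreFirst _≺_ = ∀ {v a b} → E G v a → E G v b → a ≢ b → ¬ E G a b → v ≺ a → v ≺ b → ⊥

  -- `Unique` ensures that both precedences speak of the same occurrence of `v`; the clique
  -- condition at that occurrence then makes `a` and `b` equal or adjacent.
  elim⇒noPathCentreFirst : ∀ {w} → Unique w → ElimCondition G w →
    NoPathCentreFirst λ x y → Precedes x y w
  elim⇒noPathCentreFirst {_ ∷ _} _ (clique , _) va vb a≢b ¬ab (inj₁ (refl , a∈)) (inj₁ (_ , b∈)) =
    [ a≢b , ¬ab ]′ (All.lookup (All.lookup clique (∈-filter⁺ (E? G _) a∈ va)) (∈-filter⁺ (E? G _) b∈ vb))
  elim⇒noPathCentreFirst {_ ∷ w} (v∉ ∷ _) _ _ _ _ _ (inj₁ (refl , _)) (inj₂ q) =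
    All.lookup v∉ (precedes-∈ˡ w q) refl
  elim⇒noPathCentreFirst {_ ∷ w} (v∉ ∷ _) _ _ _ _ _ (inj₂ p) (inj₁ (refl , _)) =
    All.lookup v∉ (precedes-∈ˡ w p) refl
  elim⇒noPathCentreFirst {_ ∷ _} (_ ∷ u) (_ , elim) va vb a≢b ¬ab (inj₂ p) (inj₂ q) =
    elim⇒noPathCentreFirst u elim va vb a≢b ¬ab p q

  noPathCentreFirst⇒elim : ∀ w → NoPathCentreFirst (λ x y → Precedes x y w) → ElimCondition G w
  noPathCentreFirst⇒elim []      _  = _
  noPathCentreFirst⇒elim (v ∷ r) no-path =
    All.tabulate (λ a∈ → All.tabulate (adjacent (∈-filter⁻ (E? G v) a∈) ∘ ∈-filter⁻ (E? G v))) ,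
    noPathCentreFirst⇒elim r λ va vb a≢b ¬ab p q → no-path va vb a≢b ¬ab (inj₂ p) (inj₂ q)
    where
    adjacent : ∀ {a b} → a ∈ r × E G v a → b ∈ r × E G v b → a ≡ b ⊎ E G a b
    adjacent {a} {b} (a∈ , va) (b∈ , vb) with a ≟ b | E? G a b
    ... | yes a≡b | _      = inj₁ a≡b
    ... | no _    | yes ab = inj₂ ab
    ... | no a≢b  | no ¬ab = ⊥-elim (no-path va vb a≢b ¬ab (inj₁ (refl , a∈)) (inj₁ (refl , b∈)))

  -- In the relabelled word `x` stands where `π ⟨$⟩ˡ x` stands in `w`, so the path condition can be
  -- checked on `w` itself.
  basicWord-relabel : (π : Permutation′ n) → ∀ {w} → IsBasicWord G w →
    NoPathCentreFirst (λ x y → Precedes (π ⟨$⟩ˡ x) (π ⟨$⟩ˡ y) w) →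
    IsBasicWord G (map (π ⟨$⟩ʳ_) w)
  basicWord-relabel π {w} (p , _) no-path =
    map-ordering π p ,
    noPathCentreFirst⇒elim _ λ va vb a≢b ¬ab q r →
      no-path va vb a≢b ¬ab (precedes-relabel π w q) (precedes-relabel π w r)

  ∈-basicWords⁺ : ∀ {w} → IsBasicWord G w → w ∈ basicWords G
  ∈-basicWords⁺ (p , e) = ∈-filter⁺ (ElimCondition? G) (∈-permutations⁺ _ p) e

  ∈-basicWords⁻ : ∀ {w} → w ∈ basicWords G → IsBasicWord G w
  ∈-basicWords⁻ w∈ with ∈-filter⁻ (ElimCondition? G) w∈
  ... | w∈′ , e = ∈-permutations⁻ _ w∈′ , e

  basicWords-unique : Unique (basicWords G)
  basicWords-unique = Unique.filter⁺ (ElimCondition? G) (permutations-unique (Unique.allFin⁺ n))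

  -- For a basic word `w`, this makes its relabelling by `π` a basic word with `y` before `x`,
  -- expressed in the order of `w`.
  Reverses : Permutation′ n → Fin n → Fin n → List (Fin n) → Set
  Reverses π x y w =
    NoPathCentreFirst (λ a b → Precedes (π ⟨$⟩ˡ a) (π ⟨$⟩ˡ b) w) ×
    Precedes (π ⟨$⟩ˡ y) (π ⟨$⟩ˡ x) w

  -- Every word with `x` first is recovered from a word with `y` first by undoing `π` or `ρ`, so
  -- each of the latter accounts for at most two of the former.
  numPrecedes-twoToOne : ∀ {x y} (π ρ : Permutation′ n) →
    (∀ {w} → IsBasicWord G w → Precedes x y w → Reverses π x y w ⊎ Reverses ρ x y w) →
    numPrecedes G x y ≤ 2 * numPrecedes G y x
  numPrecedes-twoToOne {x} {y} π ρ rev = begin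
    length xy                                  ≤⟨ length-mono-⊆ (Unique.filter⁺ (Precedes? x y) basicWords-unique) covered ⟩
    length (back π ++ back ρ)                  ≡⟨ length-++ (back π) ⟩
    length (back π) + length (back ρ)          ≡⟨ cong (_+ length (back ρ)) (length-map _ yx) ⟩
    length yx + length (back ρ)                ≡⟨ cong (length yx +_) (length-map _ yx) ⟩
    length yx + length yx                      ≡⟨ cong (length yx +_) (≡-sym (+-identityʳ _)) ⟩
    2 * length yx                              ∎
    where
    open ≤-Reasoning
    xy yx : List (List (Fin n))
    xy = filter (Precedes? x y) (basicWords G)
    yx = filter (Precedes? y x) (basicWords G)
    back : Permutation′ n → List (List (Fin n))
    back σ = map (map (σ ⟨$⟩ˡ_)) yx
    ∈-back : ∀ σ {w} → IsBasicWord G w → Reverses σ x y w → w ∈ back σ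
    ∈-back σ {w} basic (no-path , yx′) =
      subst (_∈ back σ) (map-cancel σ w)
        (∈-map⁺ _ (∈-filter⁺ (Precedes? y x) (∈-basicWords⁺ (basicWord-relabel σ basic no-path))
          (subst₂ (λ a b → Precedes a b (map (σ ⟨$⟩ʳ_) w)) (inverseʳ σ) (inverseʳ σ)
            (precedes-map (σ ⟨$⟩ʳ_) w yx′))))
    covered : xy ⊆ back π ++ back ρ
    covered w∈ with ∈-filter⁻ (Precedes? x y) w∈
    ... | w∈′ , x≺y with ∈-basicWords⁻ w∈′
    ...   | basic with rev basic x≺y
    ...     | inj₁ r = ∈-++⁺ˡ (∈-back π basic r)
    ...     | inj₂ r = ∈-++⁺ʳ (back π) (∈-back ρ basic r)

  numPrecedes-total : ∀ {x y} → x ≢ y → numPrecedes G x y + numPrecedes G y x ≡ numBasicWords G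
  numPrecedes-total {x} {y} x≢y = trans (≡-sym (length-++ xy)) (≤-antisym
    (length-mono-⊆ {ys = basicWords G} (Unique.++⁺ (Unique.filter⁺ (Precedes? x y) basicWords-unique)
                               (Unique.filter⁺ (Precedes? y x) basicWords-unique) disjoint)
      λ w∈ → [ proj₁ ∘ ∈-filter⁻ (Precedes? x y) , proj₁ ∘ ∈-filter⁻ (Precedes? y x) ]′ (∈-++⁻ xy w∈))
    (length-mono-⊆ basicWords-unique covered))
    where
    xy yx : List (List (Fin n))
    xy = filter (Precedes? x y) (basicWords G)
    yx = filter (Precedes? y x) (basicWords G)
    disjoint : ∀ {w} → ¬ (w ∈ xy × w ∈ yx)
    disjoint (w∈xy , w∈yx) with ∈-filter⁻ (Precedes? x y) w∈xy | ∈-filter⁻ (Precedes? y x) {xs = basicWords G} w∈yx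
    ... | w∈ , p | _ , q =
      let u = ordering-unique (proj₁ (∈-basicWords⁻ w∈)) in precedes-irrefl u (precedes-trans u p q)
    covered : basicWords G ⊆ xy ++ yx
    covered w∈ with ordering-complete (proj₁ (∈-basicWords⁻ w∈))
    ... | all with precedes-total x≢y (all x) (all y)
    ...   | inj₁ p = ∈-++⁺ˡ (∈-filter⁺ (Precedes? x y) w∈ p)
    ...   | inj₂ p = ∈-++⁺ʳ xy (∈-filter⁺ (Precedes? y x) w∈ p)

  -- If p + q = N, then q ≤ 2p gives N ≤ 3p, and p ≤ 2q gives 3p ≤ 2N.
  balanced-pair : ∀ {x y} → x ≢ y → numPrecedes G x y ≤ 2 * numPrecedes G y x →
    numPrecedes G y x ≤ 2 * numPrecedes G x y → IsBalanced G
  balanced-pair {x} {y} x≢y xy≤ yx≤ = inj₂ (x , y , x≢y , lower , upper)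
    where
    open ≤-Reasoning
    p q : ℕ
    p = numPrecedes G x y
    q = numPrecedes G y x
    lower : numBasicWords G ≤ 3 * p
    lower = begin
      numBasicWords G ≡⟨ numPrecedes-total x≢y ⟨
      p + q           ≤⟨ +-monoʳ-≤ p yx≤ ⟩
      3 * p           ∎
    upper : 3 * p ≤ 2 * numBasicWords G
    upper = begin
      p + 2 * p         ≤⟨ +-monoˡ-≤ (2 * p) xy≤ ⟩
      2 * q + 2 * p     ≡⟨ *-distribˡ-+ 2 q p ⟨
      2 * (q + p)       ≡⟨ cong (2 *_) (+-comm q p) ⟩
      2 * (p + q)       ≡⟨ cong (2 *_) (numPrecedes-total x≢y) ⟩
      2 * numBasicWords G ∎

  -- Automorphisms and twins

  Preserves : (Fin n → Fin n) → Set
  Preserves f = ∀ {a b} → E G a b → E G (f a) (f b)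

  IsAutomorphism : Permutation′ n → Set
  IsAutomorphism π = Preserves (π ⟨$⟩ʳ_) × Preserves (π ⟨$⟩ˡ_)

  -- The inverse of `π` carries an induced path a - v - b to another induced path, whose centre is
  -- not first in the basic word `w`.
  automorphism-noPathCentreFirst : ∀ π → IsAutomorphism π → ∀ {w} → IsBasicWord G w →
    NoPathCentreFirst (λ x y → Precedes (π ⟨$⟩ˡ x) (π ⟨$⟩ˡ y) w)
  automorphism-noPathCentreFirst π (presʳ , presˡ) (p , e) va vb a≢b ¬ab =
    elim⇒noPathCentreFirst (ordering-unique p) e (presˡ va) (presˡ vb)
      (λ eq → a≢b (trans (≡-sym (inverseʳ π)) (trans (cong (π ⟨$⟩ʳ_) eq) (inverseʳ π))))
      (λ e′ → ¬ab (subst₂ (E G) (inverseʳ π) (inverseʳ π) (presʳ e′)))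

  -- The automorphism turns words with `x` first into words with `y` first and conversely, so it
  -- fills both slots of `numPrecedes-twoToOne` in both directions.
  automorphism-balanced : ∀ π → IsAutomorphism π → ∀ {x y} → x ≢ y →
    π ⟨$⟩ˡ x ≡ y → π ⟨$⟩ˡ y ≡ x → IsBalanced G
  automorphism-balanced π aut {x} {y} x≢y πx πy =
    balanced-pair x≢y (numPrecedes-twoToOne π π (reverses πx πy)) (numPrecedes-twoToOne π π (reverses πy πx))
    where
    reverses : ∀ {u v} → π ⟨$⟩ˡ u ≡ v → π ⟨$⟩ˡ v ≡ u → ∀ {w} → IsBasicWord G w →
      Precedes u v w → Reverses π u v w ⊎ Reverses π u v w
    reverses πu πv {w} basic u≺v =
      inj₁ (automorphism-noPathCentreFirst π aut basic ,
            subst₂ (λ a b → Precedes a b w) (≡-sym πv) (≡-sym πu) u≺v)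

  -- Adjacent and non-adjacent twins are treated together: the pair `x`, `y` itself is left
  -- unconstrained.
  Twins : Fin n → Fin n → Set
  Twins x y = x ≢ y × (∀ z → z ≢ x → z ≢ y → adj G x z ≡ adj G y z)

  twins? : ∀ x y → Dec (Twins x y)
  twins? x y = ¬? (x ≟ y) ×-dec
    all? λ z → ¬? (z ≟ x) →-dec (¬? (z ≟ y) →-dec (adj G x z Bool.≟ adj G y z))

  swap-preserves : ∀ {x y} → Twins x y → Preserves (swapV x y)
  swap-preserves {x} {y} (x≢y , same) {a} {b} ab with a ≟ x | a ≟ y | b ≟ x | b ≟ y
  ... | yes refl | _        | yes refl | _        = contradiction refl (E⇒≢ ab)
  ... | yes refl | _        | no _     | yes refl = E-sym ab
  ... | yes refl | _        | no b≢x   | no b≢y   = subst T (same b b≢x b≢y) ab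
  ... | no _     | yes refl | yes refl | _        = E-sym ab
  ... | no _     | yes refl | no _     | yes refl = contradiction refl (E⇒≢ ab)
  ... | no _     | yes refl | no b≢x   | no b≢y   = subst T (≡-sym (same b b≢x b≢y)) ab
  ... | no a≢x   | no a≢y   | yes refl | _        = E-sym (subst T (same a a≢x a≢y) (E-sym ab))
  ... | no a≢x   | no a≢y   | no _     | yes refl = E-sym (subst T (≡-sym (same a a≢x a≢y)) (E-sym ab))
  ... | no _     | no _     | no _     | no _     = ab

  swap-automorphism : ∀ {x y} → Twins x y → IsAutomorphism (swapₚ x y)
  swap-automorphism t = swap-preserves t , swap-preserves t

  twins⇒indistinguishable : ∀ {x y} → Twins x y → Indistinguishable G x y
  twins⇒indistinguishable {x} {y} t w basic =
    basicWord-relabel (swapₚ x y) basic (automorphism-noPathCentreFirst (swapₚ x y) (swap-automorphism t) basic)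

  twins⇒balanced : ∀ {x y} → Twins x y → IsBalanced G
  twins⇒balanced {x} {y} t =
    automorphism-balanced (swapₚ x y) (swap-automorphism t) (proj₁ t) (swapV-left x y) (swapV-right x y)

  -- Pendant vertices

  Pendant : Fin n → Fin n → Set
  Pendant k i = E G i k × (∀ z → E G i z → z ≡ k)

  -- Transposing `i` with `i′` and `k` with `k′` is an automorphism: each pendant follows its
  -- neighbour, and all other vertices see `k` and `k′` alike.
  module TwoPendants {i k i′ k′ : Fin n} (pend : Pendant k i) (pend′ : Pendant k′ i′)
    (i≢k′ : i ≢ k′) (k≢k′ : k ≢ k′)
    (same : ∀ z → z ≢ i → z ≢ i′ → z ≢ k → z ≢ k′ → adj G k z ≡ adj G k′ z) where

    private
      ik   = proj₁ pend
      i′k′ = proj₁ pend′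
      i≢k : i ≢ k
      i≢k = E⇒≢ ik
      i′≢k′ : i′ ≢ k′
      i′≢k′ = E⇒≢ i′k′
      i≢i′ : i ≢ i′
      i≢i′ refl = k≢k′ (≡-sym (proj₂ pend k′ i′k′))
      i′≢k : i′ ≢ k
      i′≢k refl = i≢k′ (proj₂ pend′ i (E-sym ik))

    data Position : Fin n → Set where
      at-i  : Position i
      at-i′ : Position i′
      at-k  : Position k
      at-k′ : Position k′
      away  : ∀ {z} → z ≢ i → z ≢ i′ → z ≢ k → z ≢ k′ → Position z

    position : ∀ z → Position z
    position z with z ≟ i | z ≟ i′ | z ≟ k | z ≟ k′
    ... | yes refl | _        | _        | _        = at-i
    ... | no _     | yes refl | _        | _        = at-i′
    ... | no _     | no _     | yes refl | _        = at-k
    ... | no _     | no _     | no _     | yes refl = at-k′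
    ... | no p     | no q     | no r     | no s     = away p q r s

    -- Only the values of `f` are assumed, so that both directions of `exchange`, which compose the
    -- two swaps in opposite orders, are covered.
    exchange-preserves : (f : Fin n → Fin n) → f i ≡ i′ → f i′ ≡ i → f k ≡ k′ → f k′ ≡ k →
      (∀ {z} → z ≢ i → z ≢ i′ → z ≢ k → z ≢ k′ → f z ≡ z) → Preserves f
    exchange-preserves f fi fi′ fk fk′ fixed {a} {b} ab with position a | position b
    ... | at-i  | _ rewrite proj₂ pend b ab | fi | fk = i′k′
    ... | at-i′ | _ rewrite proj₂ pend′ b ab | fi′ | fk′ = ik
    ... | at-k  | at-i  rewrite fi | fk = E-sym i′k′
    ... | at-k  | at-i′ = contradiction (proj₂ pend′ k (E-sym ab)) k≢k′
    ... | at-k  | at-k  = contradiction refl (E⇒≢ ab)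
    ... | at-k  | at-k′ rewrite fk | fk′ = E-sym ab
    ... | at-k  | away p q r s rewrite fk | fixed p q r s = subst T (same b p q r s) ab
    ... | at-k′ | at-i  = contradiction (≡-sym (proj₂ pend k′ (E-sym ab))) k≢k′
    ... | at-k′ | at-i′ rewrite fi′ | fk′ = E-sym ik
    ... | at-k′ | at-k  rewrite fk | fk′ = E-sym ab
    ... | at-k′ | at-k′ = contradiction refl (E⇒≢ ab)
    ... | at-k′ | away p q r s rewrite fk′ | fixed p q r s = subst T (≡-sym (same b p q r s)) ab
    ... | away _ _ r _ | at-i  = contradiction (proj₂ pend a (E-sym ab)) r
    ... | away _ _ _ s | at-i′ = contradiction (proj₂ pend′ a (E-sym ab)) s
    ... | away p q r s | at-k  rewrite fk | fixed p q r s = E-sym (subst T (same a p q r s) (E-sym ab))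
    ... | away p q r s | at-k′ rewrite fk′ | fixed p q r s = E-sym (subst T (≡-sym (same a p q r s)) (E-sym ab))
    ... | away p q r s | away p′ q′ r′ s′ rewrite fixed p q r s | fixed p′ q′ r′ s′ = ab

    exchange : Permutation′ n
    exchange = swapₚ i i′ ∘ₚ swapₚ k k′

    exchange-i : exchange ⟨$⟩ˡ i ≡ i′
    exchange-i = trans (cong (swapV i i′) (swapV-other i≢k i≢k′)) (swapV-left i i′)

    exchange-i′ : exchange ⟨$⟩ˡ i′ ≡ i
    exchange-i′ = trans (cong (swapV i i′) (swapV-other i′≢k i′≢k′)) (swapV-right i i′)

    exchange-automorphism : IsAutomorphism exchange
    exchange-automorphism =
      exchange-preserves (exchange ⟨$⟩ʳ_)
        (trans (cong (swapV k k′) (swapV-left i i′)) (swapV-other i′≢k i′≢k′))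
        (trans (cong (swapV k k′) (swapV-right i i′)) (swapV-other i≢k i≢k′))
        (trans (cong (swapV k k′) (swapV-other (i≢k ∘ ≡-sym) (i′≢k ∘ ≡-sym))) (swapV-left k k′))
        (trans (cong (swapV k k′) (swapV-other (i≢k′ ∘ ≡-sym) (i′≢k′ ∘ ≡-sym))) (swapV-right k k′))
        (λ p q r s → trans (cong (swapV k k′) (swapV-other p q)) (swapV-other r s)) ,
      exchange-preserves (exchange ⟨$⟩ˡ_) exchange-i exchange-i′
        (trans (cong (swapV i i′) (swapV-left k k′)) (swapV-other (i≢k′ ∘ ≡-sym) (i′≢k′ ∘ ≡-sym)))
        (trans (cong (swapV i i′) (swapV-right k k′)) (swapV-other (i≢k ∘ ≡-sym) (i′≢k ∘ ≡-sym)))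
        (λ p q r s → trans (cong (swapV i i′) (swapV-other r s)) (swapV-other p q))

    balanced : IsBalanced G
    balanced = automorphism-balanced exchange exchange-automorphism i≢i′ exchange-i exchange-i′

  -- The triangle j k l with a pendant i at k: Pr[i < j] lies between 1/3 and 2/3 because the
  -- orderings with i < j and those with j < i map at most two-to-one into each other.
  module Paw {i j k l : Fin n} (pend : Pendant k i)
    (jk : E G j k) (jl : E G j l) (kl : E G k l) (Nj : ∀ z → E G j z → z ≡ k ⊎ z ≡ l)
    (same : ∀ z → z ≢ i → z ≢ j → z ≢ k → z ≢ l → adj G k z ≡ adj G l z) where

    private
      ik : E G i k
      ik = proj₁ pend
      i≢k : i ≢ k
      i≢k = E⇒≢ ik
      j≢k : j ≢ k
      j≢k = E⇒≢ jk
      j≢l : j ≢ l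
      j≢l = E⇒≢ jl
      k≢l : k ≢ l
      k≢l = E⇒≢ kl
      i≢j : i ≢ j
      i≢j refl = k≢l (≡-sym (proj₂ pend l jl))
      i≢l : i ≢ l
      i≢l refl = j≢k (proj₂ pend j (E-sym jl))

    Outer : Fin n → Set
    Outer z = z ≢ i × z ≢ j × z ≢ k × z ≢ l

    data Position : Fin n → Set where
      at-i  : Position i
      at-j  : Position j
      at-k  : Position k
      at-l  : Position l
      outer : ∀ {z} → Outer z → Position z

    position : ∀ z → Position z
    position z with z ≟ i | z ≟ j | z ≟ k | z ≟ l
    ... | yes refl | _        | _        | _        = at-i
    ... | no _     | yes refl | _        | _        = at-j
    ... | no _     | no _     | yes refl | _        = at-k
    ... | no _     | no _     | no _     | yes refl = at-l
    ... | no p     | no q     | no r     | no s     = outer (p , q , r , s)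

    k→l : ∀ {z} → Outer z → E G k z → E G l z
    k→l (p , q , r , s) = subst T (same _ p q r s)

    l→k : ∀ {z} → Outer z → E G l z → E G k z
    l→k (p , q , r , s) = subst T (≡-sym (same _ p q r s))

    outer≁i : ∀ {z} → Outer z → ¬ E G z i
    outer≁i (_ , _ , z≢k , _) zi = z≢k (proj₂ pend _ (E-sym zi))

    outer≁j : ∀ {z} → Outer z → ¬ E G z j
    outer≁j (_ , _ , z≢k , z≢l) zj = [ z≢k , z≢l ]′ (Nj _ (E-sym zj))

    -- The induced three-vertex paths of G, in an ordering where i, j, k, l occupy the places
    -- that ≺ assigns to pi, pj, pk, pl.
    record Admissible (_≺_ : Fin n → Fin n → Set) (pi pj pk pl : Fin n) : Set where
      field
        i-k-j : pk ≺ pi → pk ≺ pj → ⊥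
        i-k-l : pk ≺ pi → pk ≺ pl → ⊥
        i-k-x : ∀ {x} → Outer x → E G k x → pk ≺ pi → pk ≺ x → ⊥
        j-k-x : ∀ {x} → Outer x → E G k x → pk ≺ pj → pk ≺ x → ⊥
        j-l-x : ∀ {x} → Outer x → E G k x → pl ≺ pj → pl ≺ x → ⊥
        x-k-y : ∀ {x y} → Outer x → Outer y → E G k x → E G k y → x ≢ y → ¬ E G x y → pk ≺ x → pk ≺ y → ⊥
        x-l-y : ∀ {x y} → Outer x → Outer y → E G k x → E G k y → x ≢ y → ¬ E G x y → pl ≺ x → pl ≺ y → ⊥
        k-v-y : ∀ {v y} → Outer v → Outer y → E G k v → E G v y → ¬ E G k y → v ≺ pk → v ≺ y → ⊥
        l-v-y : ∀ {v y} → Outer v → Outer y → E G k v → E G v y → ¬ E G k y → v ≺ pl → v ≺ y → ⊥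
        x-v-y : ∀ {v x y} → Outer v → Outer x → Outer y → E G v x → E G v y → x ≢ y → ¬ E G x y → v ≺ x → v ≺ y → ⊥

    -- The middle letter of a field name is the centre of the path. Outer vertices see `k` and `l`
    -- alike, so adjacency to `l` is recorded as adjacency to `k`.
    admissible⁺ : ∀ {_≺_} → NoPathCentreFirst _≺_ → Admissible _≺_ i j k l
    admissible⁺ no-path = record
      { i-k-j = no-path (E-sym ik) (E-sym jk) i≢j (λ e → j≢k (proj₂ pend j e))
      ; i-k-l = no-path (E-sym ik) kl i≢l (λ e → k≢l (≡-sym (proj₂ pend l e)))
      ; i-k-x = λ o kx → no-path (E-sym ik) kx (proj₁ o ∘ ≡-sym) (outer≁i o ∘ E-sym)
      ; j-k-x = λ o kx → no-path (E-sym jk) kx (proj₁ (proj₂ o) ∘ ≡-sym) (outer≁j o ∘ E-sym)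
      ; j-l-x = λ o kx → no-path (E-sym jl) (k→l o kx) (proj₁ (proj₂ o) ∘ ≡-sym) (outer≁j o ∘ E-sym)
      ; x-k-y = λ _ _ kx ky → no-path kx ky
      ; x-l-y = λ ox oy kx ky → no-path (k→l ox kx) (k→l oy ky)
      ; k-v-y = λ { _ (_ , _ , y≢k , _) kv vy ¬ky → no-path (E-sym kv) vy (y≢k ∘ ≡-sym) ¬ky }
      ; l-v-y = λ { ov oy@(_ , _ , _ , y≢l) kv vy ¬ky →
          no-path (E-sym (k→l ov kv)) vy (y≢l ∘ ≡-sym) (¬ky ∘ l→k oy) }
      ; x-v-y = λ _ _ _ → no-path
      }

    -- The neighbourhoods of `i` and `j` are cliques, so neither is the centre of an induced path.
    -- For the other centres, each pair of ends either matches a field or does not form an induced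
    -- path.
    admissible⁻ : ∀ {_≺_} (f : Fin n → Fin n) → (∀ {z} → Outer z → f z ≡ z) →
      Admissible _≺_ (f i) (f j) (f k) (f l) → NoPathCentreFirst (λ x y → f x ≺ f y)
    admissible⁻ {_≺_} f fixed adm {v} {a} {b} va vb a≢b ¬ab v≺a v≺b =
      go (position v) (position a) (position b) va vb a≢b ¬ab v≺a v≺b
      where
      open Admissible adm
      go : ∀ {v a b} → Position v → Position a → Position b →
        E G v a → E G v b → a ≢ b → ¬ E G a b → f v ≺ f a → f v ≺ f b → ⊥
      go at-i _ _ va vb a≢b _ _ _ = a≢b (trans (proj₂ pend _ va) (≡-sym (proj₂ pend _ vb)))
      go at-j _ _ va vb a≢b ¬ab _ _ with Nj _ va | Nj _ vb
      ... | inj₁ refl | inj₁ refl = a≢b refl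
      ... | inj₁ refl | inj₂ refl = ¬ab kl
      ... | inj₂ refl | inj₁ refl = ¬ab (E-sym kl)
      ... | inj₂ refl | inj₂ refl = a≢b refl
      go at-k at-k _ va _ _ _ _ _ = E⇒≢ va refl
      go at-k _ at-k _ vb _ _ _ _ = E⇒≢ vb refl
      go at-k at-i at-i _ _ a≢b _ _ _ = a≢b refl
      go at-k at-i at-j _ _ _ _ p q = i-k-j p q
      go at-k at-i at-l _ _ _ _ p q = i-k-l p q
      go at-k at-i (outer o) _ vb _ _ p q = i-k-x o vb p (subst (_ ≺_) (fixed o) q)
      go at-k at-j at-i _ _ _ _ p q = i-k-j q p
      go at-k at-j at-j _ _ a≢b _ _ _ = a≢b refl
      go at-k at-j at-l _ _ _ ¬ab _ _ = ¬ab jl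
      go at-k at-j (outer o) _ vb _ _ p q = j-k-x o vb p (subst (_ ≺_) (fixed o) q)
      go at-k at-l at-i _ _ _ _ p q = i-k-l q p
      go at-k at-l at-j _ _ _ ¬ab _ _ = ¬ab (E-sym jl)
      go at-k at-l at-l _ _ a≢b _ _ _ = a≢b refl
      go at-k at-l (outer o) _ vb _ ¬ab _ _ = ¬ab (k→l o vb)
      go at-k (outer o) at-i va _ _ _ p q = i-k-x o va q (subst (_ ≺_) (fixed o) p)
      go at-k (outer o) at-j va _ _ _ p q = j-k-x o va q (subst (_ ≺_) (fixed o) p)
      go at-k (outer o) at-l va _ _ ¬ab _ _ = ¬ab (E-sym (k→l o va))
      go at-k (outer o) (outer o′) va vb a≢b ¬ab p q =
        x-k-y o o′ va vb a≢b ¬ab (subst (_ ≺_) (fixed o) p) (subst (_ ≺_) (fixed o′) q)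
      go at-l at-i _ va _ _ _ _ _ = k≢l (≡-sym (proj₂ pend _ (E-sym va)))
      go at-l _ at-i _ vb _ _ _ _ = k≢l (≡-sym (proj₂ pend _ (E-sym vb)))
      go at-l at-l _ va _ _ _ _ _ = E⇒≢ va refl
      go at-l _ at-l _ vb _ _ _ _ = E⇒≢ vb refl
      go at-l at-j at-j _ _ a≢b _ _ _ = a≢b refl
      go at-l at-j at-k _ _ _ ¬ab _ _ = ¬ab jk
      go at-l at-j (outer o) _ vb _ _ p q = j-l-x o (l→k o vb) p (subst (_ ≺_) (fixed o) q)
      go at-l at-k at-j _ _ _ ¬ab _ _ = ¬ab (E-sym jk)
      go at-l at-k at-k _ _ a≢b _ _ _ = a≢b refl
      go at-l at-k (outer o) _ vb _ ¬ab _ _ = ¬ab (l→k o vb)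
      go at-l (outer o) at-j va _ _ _ p q = j-l-x o (l→k o va) q (subst (_ ≺_) (fixed o) p)
      go at-l (outer o) at-k va _ _ ¬ab _ _ = ¬ab (E-sym (l→k o va))
      go at-l (outer o) (outer o′) va vb a≢b ¬ab p q =
        x-l-y o o′ (l→k o va) (l→k o′ vb) a≢b ¬ab (subst (_ ≺_) (fixed o) p) (subst (_ ≺_) (fixed o′) q)
      go (outer o) at-i _ va _ _ _ _ _ = outer≁i o va
      go (outer o) _ at-i _ vb _ _ _ _ = outer≁i o vb
      go (outer o) at-j _ va _ _ _ _ _ = outer≁j o va
      go (outer o) _ at-j _ vb _ _ _ _ = outer≁j o vb
      go (outer _) at-k at-k _ _ a≢b _ _ _ = a≢b refl
      go (outer _) at-k at-l _ _ _ ¬ab _ _ = ¬ab kl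
      go (outer _) at-l at-k _ _ _ ¬ab _ _ = ¬ab (E-sym kl)
      go (outer _) at-l at-l _ _ a≢b _ _ _ = a≢b refl
      go (outer o) at-k (outer o′) va vb _ ¬ab p q =
        k-v-y o o′ (E-sym va) vb ¬ab (subst (_≺ _) (fixed o) p) (subst₂ _≺_ (fixed o) (fixed o′) q)
      go (outer o) (outer o′) at-k va vb _ ¬ab p q =
        k-v-y o o′ (E-sym vb) va (¬ab ∘ E-sym) (subst (_≺ _) (fixed o) q) (subst₂ _≺_ (fixed o) (fixed o′) p)
      go (outer o) at-l (outer o′) va vb _ ¬ab p q =
        l-v-y o o′ (l→k o (E-sym va)) vb (¬ab ∘ k→l o′) (subst (_≺ _) (fixed o) p) (subst₂ _≺_ (fixed o) (fixed o′) q)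
      go (outer o) (outer o′) at-l va vb _ ¬ab p q =
        l-v-y o o′ (l→k o (E-sym vb)) va (¬ab ∘ E-sym ∘ k→l o′) (subst (_≺ _) (fixed o) q) (subst₂ _≺_ (fixed o) (fixed o′) p)
      go (outer o) (outer o′) (outer o″) va vb a≢b ¬ab p q =
        x-v-y o o′ o″ va vb a≢b ¬ab (subst₂ _≺_ (fixed o) (fixed o′) p) (subst₂ _≺_ (fixed o) (fixed o″) q)

    -- Exchanging `i` and `j` turns i - k - l and j - l - x into j - k - l and i - l - x, which are
    -- not induced paths of G. The two hypotheses recover these fields; the others are permuted or
    -- unchanged.
    swap-admissible : ∀ {_≺_} → Admissible _≺_ i j k l → (k ≺ j → k ≺ i) → (l ≺ i → l ≺ j) → Admissible _≺_ j i k l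
    swap-admissible adm kj⇒ki li⇒lj = record
      { i-k-j = λ p q → i-k-j q p
      ; i-k-l = λ p q → i-k-l (kj⇒ki p) q
      ; i-k-x = j-k-x
      ; j-k-x = i-k-x
      ; j-l-x = λ o e p → j-l-x o e (li⇒lj p)
      ; x-k-y = x-k-y
      ; x-l-y = x-l-y
      ; k-v-y = k-v-y
      ; l-v-y = l-v-y
      ; x-v-y = x-v-y
      }
      where open Admissible adm

    module _ {_≺_ : Fin n → Fin n → Set} (≺-trans : ∀ {x y z} → x ≺ y → y ≺ z → x ≺ z)
      (≺-irrefl : ∀ {x} → ¬ x ≺ x) (≺-total : ∀ {x y} → x ≢ y → x ≺ y ⊎ y ≺ x)
      (adm : Admissible _≺_ i j k l) where
      open Admissible adm

      -- The places of `j`, `l`, `i`, in this order, are refilled with `i`, `j`, `l`. Thus `l` moves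
      -- later and follows `j`, which makes `j-l-x` vacuous.
      jl-cycle-admissible : j ≺ l → l ≺ i → Admissible _≺_ j l k i
      jl-cycle-admissible j≺l l≺i = record
        { i-k-j = λ p q → i-k-l (≺-trans p (≺-trans j≺l l≺i)) q
        ; i-k-l = λ p q → i-k-j q p
        ; i-k-x = j-k-x
        ; j-k-x = λ o e p → i-k-x o e (≺-trans p l≺i)
        ; j-l-x = λ _ _ p _ → ≺-irrefl (≺-trans p l≺i)
        ; x-k-y = x-k-y
        ; x-l-y = λ ox oy kx ky x≢y ¬xy p q →
            x-l-y ox oy kx ky x≢y ¬xy (≺-trans l≺i p) (≺-trans l≺i q)
        ; k-v-y = k-v-y
        -- `v` precedes the new place of `l` but perhaps not the old one, so it is compared with
        -- `k`: if `k` comes first, `k` precedes both `i` and `v`, against `i-k-x`.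
        ; l-v-y = λ { ov@(_ , _ , v≢k , _) oy kv vy ¬ky p q →
            [ (λ v≺k → k-v-y ov oy kv vy ¬ky v≺k q)
            , (λ k≺v → i-k-x ov kv (≺-trans k≺v p) k≺v) ]′ (≺-total v≢k) }
        ; x-v-y = x-v-y
        }

      -- The places of `i`, `k`, `j`, in this order, are refilled with `j`, `i`, `k`. Thus `k` ends
      -- up after `i` and `j`, which makes the four fields centred at `k` with an end `i` or `j`
      -- vacuous.
      ik-cycle-admissible : i ≺ k → k ≺ j → Admissible _≺_ k i j l
      ik-cycle-admissible i≺k k≺j = record
        { i-k-j = λ p _ → ≺-irrefl (≺-trans p k≺j)
        ; i-k-l = λ p _ → ≺-irrefl (≺-trans p k≺j)
        ; i-k-x = λ _ _ p _ → ≺-irrefl (≺-trans p k≺j)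
        ; j-k-x = λ _ _ p _ → ≺-irrefl (≺-trans p (≺-trans i≺k k≺j))
        ; j-l-x = λ o e p → j-l-x o e (≺-trans p (≺-trans i≺k k≺j))
        ; x-k-y = λ ox oy kx ky x≢y ¬xy p q →
            x-k-y ox oy kx ky x≢y ¬xy (≺-trans k≺j p) (≺-trans k≺j q)
        ; x-l-y = x-l-y
        -- `v` precedes the old place of `j`; if it does not precede the old place of `k`, then `k`
        -- precedes both `j` and `v`, against `j-k-x`.
        ; k-v-y = λ { ov@(_ , _ , v≢k , _) oy kv vy ¬ky p q →
            [ (λ v≺k → k-v-y ov oy kv vy ¬ky v≺k q)
            , (λ k≺v → j-k-x ov kv (≺-trans k≺v p) k≺v) ]′ (≺-total v≢k) }
        ; l-v-y = l-v-y
        ; x-v-y = x-v-y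
        }

    private
      relabelled : ∀ {w} (f : Fin n → Fin n) {pi pj pk pl} → (∀ {z} → Outer z → f z ≡ z) →
        f i ≡ pi → f j ≡ pj → f k ≡ pk → f l ≡ pl →
        Admissible (λ x y → Precedes x y w) pi pj pk pl →
        NoPathCentreFirst (λ x y → Precedes (f x) (f y) w)
      relabelled f fixed refl refl refl refl = admissible⁻ f fixed

      module Ordering {w} (basic : IsBasicWord G w) where
        _≺_ : Fin n → Fin n → Set
        x ≺ y = Precedes x y w
        unique : Unique w
        unique = ordering-unique (proj₁ basic)
        ≺-trans : ∀ {x y z} → x ≺ y → y ≺ z → x ≺ z
        ≺-trans = precedes-trans unique
        ≺-irrefl : ∀ {x} → ¬ x ≺ x
        ≺-irrefl = precedes-irrefl unique
        ≺-total : ∀ {x y} → x ≢ y → x ≺ y ⊎ y ≺ x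
        ≺-total x≢y = precedes-total x≢y (ordering-complete (proj₁ basic) _) (ordering-complete (proj₁ basic) _)
        adm : Admissible _≺_ i j k l
        adm = admissible⁺ (elim⇒noPathCentreFirst unique (proj₂ basic))

        swapped : (k ≺ j → k ≺ i) → (l ≺ i → l ≺ j) →
          NoPathCentreFirst (λ x y → swapV i j x ≺ swapV i j y)
        swapped p q = relabelled (swapV i j) (λ { (z≢i , z≢j , _) → swapV-other z≢i z≢j })
          (swapV-left i j) (swapV-right i j)
          (swapV-other (i≢k ∘ ≡-sym) (j≢k ∘ ≡-sym)) (swapV-other (i≢l ∘ ≡-sym) (j≢l ∘ ≡-sym))
          (swap-admissible adm p q)

      -- The inverses, which send a letter to its old place, are the 3-cycles i ↦ k ↦ j ↦ i and i ↦
      -- j ↦ l ↦ i.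
      ik-cycle jl-cycle : Permutation′ n
      ik-cycle = swapₚ i k ∘ₚ swapₚ j k
      jl-cycle = swapₚ i j ∘ₚ swapₚ j l

      ik-cycle-i : ik-cycle ⟨$⟩ˡ i ≡ k
      ik-cycle-i = trans (cong (swapV i k) (swapV-other i≢j i≢k)) (swapV-left i k)
      ik-cycle-j : ik-cycle ⟨$⟩ˡ j ≡ i
      ik-cycle-j = trans (cong (swapV i k) (swapV-left j k)) (swapV-right i k)
      jl-cycle-i : jl-cycle ⟨$⟩ˡ i ≡ j
      jl-cycle-i = trans (cong (swapV i j) (swapV-other i≢j i≢l)) (swapV-left i j)
      jl-cycle-j : jl-cycle ⟨$⟩ˡ j ≡ l
      jl-cycle-j = trans (cong (swapV i j) (swapV-left j l)) (swapV-other (i≢l ∘ ≡-sym) (j≢l ∘ ≡-sym))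

      -- When `i` precedes `j`, only `k` lying between them obstructs the plain swap; the 3-cycle
      -- handles that case.
      reverse-ij : ∀ {w} → IsBasicWord G w → Precedes i j w →
        Reverses (swapₚ i j) i j w ⊎ Reverses ik-cycle i j w
      reverse-ij {w} basic i≺j with Precedes? i k w ×-dec Precedes? k j w
      ... | yes (i≺k , k≺j) = inj₂
        ( relabelled (ik-cycle ⟨$⟩ˡ_)
            (λ { (z≢i , z≢j , z≢k , _) → trans (cong (swapV i k) (swapV-other z≢j z≢k)) (swapV-other z≢i z≢k) })
            ik-cycle-i ik-cycle-j
            (trans (cong (swapV i k) (swapV-right j k)) (swapV-other (i≢j ∘ ≡-sym) j≢k))
            (trans (cong (swapV i k) (swapV-other (j≢l ∘ ≡-sym) (k≢l ∘ ≡-sym))) (swapV-other (i≢l ∘ ≡-sym) (k≢l ∘ ≡-sym)))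
            (ik-cycle-admissible ≺-trans ≺-irrefl ≺-total adm i≺k k≺j)
        , subst₂ _≺_ (≡-sym ik-cycle-j) (≡-sym ik-cycle-i) i≺k )
        where open Ordering basic
      ... | no not-between = inj₁
        ( swapped (λ k≺j → [ id , (λ i≺k → contradiction (i≺k , k≺j) not-between) ]′ (≺-total (i≢k ∘ ≡-sym)))
                  (λ l≺i → ≺-trans l≺i i≺j)
        , subst₂ _≺_ (≡-sym (swapV-right i j)) (≡-sym (swapV-left i j)) i≺j )
        where open Ordering basic

      -- When `j` precedes `i`, the obstruction to the swap is `l` lying between them.
      reverse-ji : ∀ {w} → IsBasicWord G w → Precedes j i w →
        Reverses (swapₚ i j) j i w ⊎ Reverses jl-cycle j i w
      reverse-ji {w} basic j≺i with Precedes? j l w ×-dec Precedes? l i w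
      ... | yes (j≺l , l≺i) = inj₂
        ( relabelled (jl-cycle ⟨$⟩ˡ_)
            (λ { (z≢i , z≢j , _ , z≢l) → trans (cong (swapV i j) (swapV-other z≢j z≢l)) (swapV-other z≢i z≢j) })
            jl-cycle-i jl-cycle-j
            (trans (cong (swapV i j) (swapV-other (j≢k ∘ ≡-sym) k≢l)) (swapV-other (i≢k ∘ ≡-sym) (j≢k ∘ ≡-sym)))
            (trans (cong (swapV i j) (swapV-right j l)) (swapV-right i j))
            (jl-cycle-admissible ≺-trans ≺-irrefl ≺-total adm j≺l l≺i)
        , subst₂ _≺_ (≡-sym jl-cycle-i) (≡-sym jl-cycle-j) j≺l )
        where open Ordering basic
      ... | no not-between = inj₁
        ( swapped (λ k≺j → ≺-trans k≺j j≺i)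
                  (λ l≺i → [ id , (λ j≺l → contradiction (j≺l , l≺i) not-between) ]′ (≺-total (j≢l ∘ ≡-sym)))
        , subst₂ _≺_ (≡-sym (swapV-left i j)) (≡-sym (swapV-right i j)) j≺i )
        where open Ordering basic

    balanced : IsBalanced G
    balanced = balanced-pair i≢j
      (numPrecedes-twoToOne (swapₚ i j) ik-cycle reverse-ij)
      (numPrecedes-twoToOne (swapₚ i j) jl-cycle reverse-ji)

least : ∀ {n} {P : Fin n → Set} → (∀ v → Dec (P v)) → (m : Fin n → ℕ) → ∃ P →
  ∃[ v ] (P v × (∀ u → P u → m v ≤ m u))
least {n} {P} P? m (v , pv) = descend v (<-wellFounded (m v)) pv
  where
  descend : ∀ v → Acc _<_ (m v) → P v → ∃[ v ] (P v × (∀ u → P u → m v ≤ m u))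
  descend v (acc rec) pv with any? (λ u → P? u ×-dec (m u <? m v))
  ... | yes (u , pu , u<v) = descend u (rec u<v) pu
  ... | no minimal = v , pv , λ u pu → ≮⇒≥ λ u<v → minimal (u , pu , u<v)

-- Distance-hereditary split graphs

module _ {n : ℕ} (G : Graph n) where

  path-of-length-2 : ∀ {a e d} → E G a e → E G e d → a ≢ d → ¬ E G a d → ∃ (IsInducedPath G a d 2)
  path-of-length-2 {a} {e} {d} ae ed a≢d ¬ad = p , refl , refl , injective , edges , nonEdges
    where
    p : Fin 3 → Fin n
    p zero             = a
    p (suc zero)       = e
    p (suc (suc zero)) = d
    injective : ∀ i j → p i ≡ p j → i ≡ j
    injective zero             zero             _  = refl
    injective zero             (suc zero)       eq = contradiction eq (E⇒≢ G ae)
    injective zero             (suc (suc zero)) eq = contradiction eq a≢d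
    injective (suc zero)       zero             eq = contradiction (≡-sym eq) (E⇒≢ G ae)
    injective (suc zero)       (suc zero)       _  = refl
    injective (suc zero)       (suc (suc zero)) eq = contradiction eq (E⇒≢ G ed)
    injective (suc (suc zero)) zero             eq = contradiction (≡-sym eq) a≢d
    injective (suc (suc zero)) (suc zero)       eq = contradiction (≡-sym eq) (E⇒≢ G ed)
    injective (suc (suc zero)) (suc (suc zero)) _  = refl
    edges : ∀ i j → suc (toℕ i) ≡ toℕ j → E G (p i) (p j)
    edges zero             (suc zero)       _ = ae
    edges (suc zero)       (suc (suc zero)) _ = ed
    edges (suc (suc zero)) zero             ()
    edges (suc (suc zero)) (suc zero)       ()
    edges (suc (suc zero)) (suc (suc zero)) ()
    nonEdges : ∀ i j → suc (toℕ i) < toℕ j → ¬ E G (p i) (p j)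
    nonEdges zero          (suc (suc zero)) _ = ¬ad
    nonEdges zero          (suc zero)       (s≤s ())
    nonEdges (suc zero)    (suc (suc zero)) (s≤s (s≤s ()))
    nonEdges (suc (suc zero)) (suc (suc zero)) (s≤s (s≤s ()))

  path-of-length-3 : ∀ {a b c d} → E G a b → E G b c → E G c d →
    a ≢ c → a ≢ d → b ≢ d → ¬ E G a c → ¬ E G a d → ¬ E G b d → ∃ (IsInducedPath G a d 3)
  path-of-length-3 {a} {b} {c} {d} ab bc cd a≢c a≢d b≢d ¬ac ¬ad ¬bd =
    p , refl , refl , injective , edges , nonEdges
    where
    p : Fin 4 → Fin n
    p zero                   = a
    p (suc zero)             = b
    p (suc (suc zero))       = c
    p (suc (suc (suc zero))) = d
    injective : ∀ i j → p i ≡ p j → i ≡ j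
    injective zero                   zero                   _  = refl
    injective zero                   (suc zero)             eq = contradiction eq (E⇒≢ G ab)
    injective zero                   (suc (suc zero))       eq = contradiction eq a≢c
    injective zero                   (suc (suc (suc zero))) eq = contradiction eq a≢d
    injective (suc zero)             zero                   eq = contradiction (≡-sym eq) (E⇒≢ G ab)
    injective (suc zero)             (suc zero)             _  = refl
    injective (suc zero)             (suc (suc zero))       eq = contradiction eq (E⇒≢ G bc)
    injective (suc zero)             (suc (suc (suc zero))) eq = contradiction eq b≢d
    injective (suc (suc zero))       zero                   eq = contradiction (≡-sym eq) a≢c
    injective (suc (suc zero))       (suc zero)             eq = contradiction (≡-sym eq) (E⇒≢ G bc)
    injective (suc (suc zero))       (suc (suc zero))       _  = refl
    injective (suc (suc zero))       (suc (suc (suc zero))) eq = contradiction eq (E⇒≢ G cd)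
    injective (suc (suc (suc zero))) zero                   eq = contradiction (≡-sym eq) a≢d
    injective (suc (suc (suc zero))) (suc zero)             eq = contradiction (≡-sym eq) b≢d
    injective (suc (suc (suc zero))) (suc (suc zero))       eq = contradiction (≡-sym eq) (E⇒≢ G cd)
    injective (suc (suc (suc zero))) (suc (suc (suc zero))) _  = refl
    edges : ∀ i j → suc (toℕ i) ≡ toℕ j → E G (p i) (p j)
    edges zero                   (suc zero)             _ = ab
    edges (suc zero)             (suc (suc zero))       _ = bc
    edges (suc (suc zero))       (suc (suc (suc zero))) _ = cd
    edges (suc (suc (suc zero))) (suc (suc (suc zero))) ()
    nonEdges : ∀ i j → suc (toℕ i) < toℕ j → ¬ E G (p i) (p j)
    nonEdges zero                   (suc (suc zero))       _ = ¬ac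
    nonEdges zero                   (suc (suc (suc zero))) _ = ¬ad
    nonEdges (suc zero)             (suc (suc (suc zero))) _ = ¬bd
    nonEdges zero                   (suc zero)             (s≤s ())
    nonEdges (suc zero)             (suc zero)             (s≤s ())
    nonEdges (suc zero)             (suc (suc zero))       (s≤s (s≤s ()))
    nonEdges (suc (suc zero))       (suc (suc zero))       (s≤s (s≤s ()))
    nonEdges (suc (suc zero))       (suc (suc (suc zero))) (s≤s (s≤s (s≤s ())))
    nonEdges (suc (suc (suc zero))) (suc (suc (suc zero))) (s≤s (s≤s (s≤s ())))

  -- The induced paths a - b - c - d and a - e - d have the same ends. Depending on how `e` is
  -- joined to `b` and `c`, the configuration is a gem, a house or a 5-cycle.
  gem-free : IsDistanceHereditary G → ∀ {a b c d e} →
    E G a b → E G b c → E G c d → a ≢ c → a ≢ d → b ≢ d → ¬ E G a c → ¬ E G a d → ¬ E G b d →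
    E G a e → E G e d → ⊥
  gem-free dh ab bc cd a≢c a≢d b≢d ¬ac ¬ad ¬bd ae ed
    with dh _ _ _ _ _ _ (proj₂ (path-of-length-3 ab bc cd a≢c a≢d b≢d ¬ac ¬ad ¬bd))
                        (proj₂ (path-of-length-2 ae ed a≢d ¬ad))
  ... | ()

  adj-≡ : ∀ {a b z} → (E G a z → E G b z) → (E G b z → E G a z) → adj G a z ≡ adj G b z
  adj-≡ {a} {b} {z} to from with adj G a z | adj G b z
  ... | true  | true  = refl
  ... | true  | false = ⊥-elim (to _)
  ... | false | true  = ⊥-elim (from _)
  ... | false | false = refl

  degree : Fin n → ℕ
  degree v = length (filter (E? G v) (allFin n))

  degree-mono-< : ∀ {a b d} → (∀ {c} → E G d c → E G a c) → E G a b → ¬ E G d b → degree d < degree a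
  degree-mono-< {a} {b} {d} d⊆a ab ¬db =
    length-mono-⊆ (All.tabulate b∉ ∷ Unique.filter⁺ (E? G d) (Unique.allFin⁺ n)) sub
    where
    b∉ : ∀ {z} → z ∈ filter (E? G d) (allFin n) → b ≢ z
    b∉ z∈ refl = ¬db (proj₂ (∈-filter⁻ (E? G d) {xs = allFin n} z∈))
    sub : b ∷ filter (E? G d) (allFin n) ⊆ filter (E? G a) (allFin n)
    sub (here refl) = ∈-filter⁺ (E? G a) (∈-allFin _) ab
    sub (there z∈)  = ∈-filter⁺ (E? G a) (∈-allFin _) (d⊆a (proj₂ (∈-filter⁻ (E? G d) {xs = allFin n} z∈)))

  -- Twin-free distance-hereditary split graphs: the bound on simplicial vertices

  module TwinFreeSplit (K : Fin n → Bool)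
    (clique : ∀ u v → u ≢ v → K u ≡ true → K v ≡ true → E G u v)
    (independent : ∀ u v → K u ≡ false → K v ≡ false → ¬ E G u v)
    (dh : IsDistanceHereditary G)
    (twin-free : ∀ {x y} → x ≢ y → ¬ (∀ z → z ≢ x → z ≢ y → (E G x z → E G y z) × (E G y z → E G x z)))
    where

    InK InI : Fin n → Set
    InK v = K v ≡ true
    InI v = K v ≡ false

    side : ∀ v → InK v ⊎ InI v
    side v with K v
    ... | true  = inj₁ refl
    ... | false = inj₂ refl

    sides-differ : ∀ {u v} → InK u → InI v → u ≢ v
    sides-differ u∈K v∈I refl with trans (≡-sym u∈K) v∈I
    ... | ()

    I-neighbour : ∀ {v z} → InI v → E G v z → InK z
    I-neighbour {v} {z} v∈I vz with side z
    ... | inj₁ z∈K = z∈K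
    ... | inj₂ z∈I = ⊥-elim (independent v z v∈I z∈I vz)

    -- A neighbour `c` of `d` missed by `a` would give the induced path a - b - c - d, with `e`
    -- adjacent to both ends.
    laminar : ∀ {a d e b} → InI a → InI d → E G a e → E G d e → E G a b → ¬ E G d b →
      ∀ {c} → E G d c → E G a c
    laminar {a} {d} {e} {b} a∈I d∈I ae de ab ¬db {c} dc = decidable-stable (E? G a c) λ ¬ac →
      gem-free dh ab
        (clique b c (λ { refl → ¬db dc }) (I-neighbour a∈I ab) (I-neighbour d∈I dc)) (E-sym G dc)
        (sides-differ (I-neighbour d∈I dc) a∈I ∘ ≡-sym) (λ { refl → ¬db ab })
        (sides-differ (I-neighbour a∈I ab) d∈I) ¬ac (independent a d a∈I d∈I) (¬db ∘ E-sym G)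
        ae (E-sym G de)

    INeighbour : Fin n → Fin n → Set
    INeighbour k i = InI i × E G k i

    iNeighbour? : ∀ k i → Dec (INeighbour k i)
    iNeighbour? k i = (K i Bool.≟ false) ×-dec E? G k i

    Smallest : Fin n → Fin n → Set
    Smallest k i = InK k × INeighbour k i × (∀ u → INeighbour k u → degree i ≤ degree u)

    -- The neighbourhoods of `i` and `z` share `k`. If `z` missed `k′`, laminarity would put its
    -- neighbourhood strictly inside that of `i`, against the minimal degree of `i`.
    smallest-spreads : ∀ {k k′ i} → Smallest k i → E G k′ i → ∀ {z} → INeighbour k z → E G k′ z
    smallest-spreads {k} {k′} {i} (_ , (i∈I , ki) , min) k′i {z} (z∈I , kz) =
      decidable-stable (E? G k′ z) λ ¬k′z →
        <-irrefl refl (≤-trans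
          (degree-mono-< (laminar i∈I z∈I (E-sym G ki) (E-sym G kz) (E-sym G k′i) (¬k′z ∘ E-sym G))
            (E-sym G k′i) (¬k′z ∘ E-sym G))
          (min z (z∈I , kz)))

    smallest-injective : ∀ {k k′ i} → Smallest k i → Smallest k′ i → k ≡ k′
    smallest-injective {k} {k′} s@(k∈K , (_ , ki) , _) s′@(k′∈K , (_ , k′i) , _) =
      decidable-stable (k ≟ k′) λ k≢k′ → twin-free k≢k′ λ z z≢k z≢k′ →
        [ (λ z∈K → (λ _ → clique k′ z (z≢k′ ∘ ≡-sym) k′∈K z∈K) , (λ _ → clique k z (z≢k ∘ ≡-sym) k∈K z∈K))
        , (λ z∈I → (λ kz → smallest-spreads s k′i (z∈I , kz)) , (λ k′z → smallest-spreads s′ ki (z∈I , k′z))) ]′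
        (side z)

    -- A sufficient condition for being simplicial, chosen so that its complement consists of the
    -- clique vertices that have a smallest I-neighbour.
    Early : Fin n → Set
    Early v = InI v ⊎ ¬ ∃ (INeighbour v)

    early? : ∀ v → Dec (Early v)
    early? v = (K v Bool.≟ false) ⊎-dec ¬? (any? (iNeighbour? v))

    early⇒simplicial : ∀ {v} → Early v → IsSimplicial G v
    early⇒simplicial {v} early a b va vb a≢b = clique a b a≢b (inK early va) (inK early vb)
      where
      inK : Early v → ∀ {a} → E G v a → InK a
      inK (inj₁ v∈I) va = I-neighbour v∈I va
      inK (inj₂ none) {a} va with side a
      ... | inj₁ a∈K = a∈K
      ... | inj₂ a∈I = ⊥-elim (none (a , a∈I , va))

    halfSimplicial : HalfSimplicial G
    halfSimplicial = S , Unique.filter⁺ early? (Unique.allFin⁺ n) ,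
      All.tabulate (λ v∈ → early⇒simplicial (proj₂ (∈-filter⁻ early? {xs = allFin n} v∈))) , (begin
        n                       ≡⟨ length-tabulate {n = n} id ⟨
        length (allFin n)       ≤⟨ length-mono-⊆ (Unique.allFin⁺ n) (λ {v} _ → covered v) ⟩
        length (S ++ L)         ≡⟨ length-++ S ⟩
        length S + length L     ≤⟨ +-monoʳ-≤ (length S) L≤S ⟩
        length S + length S     ≡⟨ cong (length S +_) (≡-sym (+-identityʳ _)) ⟩
        2 * length S            ∎)
      where
      open ≤-Reasoning
      S L : List (Fin n)
      S = filter early? (allFin n)
      L = filter (¬? ∘ early?) (allFin n)
      covered : ∀ v → v ∈ S ++ L
      covered v with early? v
      ... | yes early = ∈-++⁺ˡ (∈-filter⁺ early? (∈-allFin v) early)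
      ... | no late   = ∈-++⁺ʳ S (∈-filter⁺ (¬? ∘ early?) (∈-allFin v) late)
      image : ∀ {k} → k ∈ L → ∃[ i ] (i ∈ S × Smallest k i)
      image {k} k∈ with proj₂ (∈-filter⁻ (¬? ∘ early?) {xs = allFin n} k∈) | side k
      ... | late | inj₂ k∈I = contradiction (inj₁ k∈I) late
      ... | late | inj₁ k∈K
        with least (iNeighbour? k) degree (decidable-stable (any? (iNeighbour? k)) (late ∘ inj₂))
      ...   | i , nb@(i∈I , _) , min = i , ∈-filter⁺ early? (∈-allFin i) (inj₁ i∈I) , k∈K , nb , min
      -- Each late vertex is sent to its smallest I-neighbour, which is early because it lies in I.
      L≤S : length L ≤ length S
      L≤S = length-mono-injective (Unique.filter⁺ (¬? ∘ early?) (Unique.allFin⁺ n)) image smallest-injective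

    -- Twin-free distance-hereditary split graphs: a balanced pair

    HasPendant : Fin n → Set
    HasPendant k = ∃[ i ] (InI i × Pendant G k i)

    hasPendant? : ∀ k → Dec (HasPendant k)
    hasPendant? k = any? λ i → (K i Bool.≟ false) ×-dec (E? G i k ×-dec all? λ z → E? G i z →-dec (z ≟ k))

    -- Two pendants at the same vertex would be twins.
    pendant-unique : ∀ {k i i′} → Pendant G k i → Pendant G k i′ → i ≡ i′
    pendant-unique {k} {i} {i′} (ik , Ni) (i′k , Ni′) = decidable-stable (i ≟ i′) λ i≢i′ →
      twin-free i≢i′ λ z _ _ →
        (λ iz → subst (E G i′) (≡-sym (Ni z iz)) i′k) , (λ i′z → subst (E G i) (≡-sym (Ni′ z i′z)) ik)

    -- For clique vertices, domination in both directions means that only their pendants tell `u`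
    -- and `v` apart.
    Dominates : Fin n → Fin n → Set
    Dominates v u = ∀ {z} → InI z → E G u z → E G v z ⊎ Pendant G u z

    same-status : ∀ {u v} → InK u → InK v → u ≢ v → Dominates v u → Dominates u v →
      (HasPendant u × HasPendant v) ⊎ (¬ HasPendant u × ¬ HasPendant v) → IsBalanced G
    same-status {u} {v} u∈K v∈K u≢v uv vu (inj₁ ((i , i∈I , pend) , (i′ , i′∈I , pend′))) =
      TwoPendants.balanced G pend pend′ (sides-differ v∈K i∈I ∘ ≡-sym) u≢v same
      where
      same : ∀ z → z ≢ i → z ≢ i′ → z ≢ u → z ≢ v → adj G u z ≡ adj G v z
      same z z≢i z≢i′ z≢u z≢v with side z
      ... | inj₁ z∈K = adj-≡ (λ _ → clique v z (z≢v ∘ ≡-sym) v∈K z∈K) (λ _ → clique u z (z≢u ∘ ≡-sym) u∈K z∈K)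
      ... | inj₂ z∈I = adj-≡
        (λ uz → [ id , (λ p → contradiction (pendant-unique p pend) z≢i) ]′ (uv z∈I uz))
        (λ vz → [ id , (λ p → contradiction (pendant-unique p pend′) z≢i′) ]′ (vu z∈I vz))
    same-status {u} {v} u∈K v∈K u≢v uv vu (inj₂ (none-u , none-v)) = ⊥-elim (twin-free u≢v same)
      where
      same : ∀ z → z ≢ u → z ≢ v → (E G u z → E G v z) × (E G v z → E G u z)
      same z z≢u z≢v with side z
      ... | inj₁ z∈K = (λ _ → clique v z (z≢v ∘ ≡-sym) v∈K z∈K) , (λ _ → clique u z (z≢u ∘ ≡-sym) u∈K z∈K)
      ... | inj₂ z∈I =
        (λ uz → [ id , (λ p → contradiction (z , z∈I , p) none-u) ]′ (uv z∈I uz)) ,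
        (λ vz → [ id , (λ p → contradiction (z , z∈I , p) none-v) ]′ (vu z∈I vz))

    -- In a set of clique vertices distinguished only by their pendants, two have pendants (and can
    -- be exchanged together with them), or two have none (and are twins), unless the set is {k , l}.
    module Block (B : Fin n → Set) (B? : ∀ v → Dec (B v)) (B⊆K : ∀ {v} → B v → InK v)
      (dominates : ∀ {u v} → B u → B v → u ≢ v → Dominates v u) where

      OnePendant : Set
      OnePendant = ∃[ k ] ∃[ l ] (B k × B l × k ≢ l × HasPendant k × ¬ HasPendant l ×
        (∀ {z} → B z → z ≡ k ⊎ z ≡ l))

      same-status-block : ∀ {u v} → B u → B v → u ≢ v →
        (HasPendant u × HasPendant v) ⊎ (¬ HasPendant u × ¬ HasPendant v) → IsBalanced G
      same-status-block u∈ v∈ u≢v =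
        same-status (B⊆K u∈) (B⊆K v∈) u≢v (dominates u∈ v∈ u≢v) (dominates v∈ u∈ (u≢v ∘ ≡-sym))

      -- A third member of `B` shares its status with `k` or with `l`, so only a two-element `B`
      -- escapes `same-status-block`.
      one-pendant : ∀ {k l} → B k → B l → k ≢ l → HasPendant k → ¬ HasPendant l → IsBalanced G ⊎ OnePendant
      one-pendant {k} {l} k∈ l∈ k≢l pk ¬pl with any? (λ z → B? z ×-dec (¬? (z ≟ k) ×-dec ¬? (z ≟ l)))
      ... | no none = inj₂ (k , l , k∈ , l∈ , k≢l , pk , ¬pl , only)
        where
        only : ∀ {z} → B z → z ≡ k ⊎ z ≡ l
        only {z} z∈ with z ≟ k | z ≟ l
        ... | yes z≡k | _       = inj₁ z≡k
        ... | no _    | yes z≡l = inj₂ z≡l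
        ... | no z≢k  | no z≢l  = contradiction (z , z∈ , z≢k , z≢l) none
      ... | yes (z , z∈ , z≢k , z≢l) with hasPendant? z
      ...   | yes pz = inj₁ (same-status-block z∈ k∈ z≢k (inj₁ (pz , pk)))
      ...   | no ¬pz = inj₁ (same-status-block z∈ l∈ z≢l (inj₂ (¬pz , ¬pl)))

      balanced-or-one-pendant : ∀ {u v} → B u → B v → u ≢ v → IsBalanced G ⊎ OnePendant
      balanced-or-one-pendant {u} {v} u∈ v∈ u≢v with hasPendant? u | hasPendant? v
      ... | yes pu | yes pv = inj₁ (same-status-block u∈ v∈ u≢v (inj₁ (pu , pv)))
      ... | yes pu | no ¬pv = one-pendant u∈ v∈ u≢v pu ¬pv
      ... | no ¬pu | yes pv = one-pendant v∈ u∈ (u≢v ∘ ≡-sym) pv ¬pu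
      ... | no ¬pu | no ¬pv = inj₁ (same-status-block u∈ v∈ u≢v (inj₂ (¬pu , ¬pv)))

    Branching : Fin n → Set
    Branching j = InI j × ∃[ u ] ∃[ v ] (u ≢ v × E G j u × E G j v)

    branching? : ∀ j → Dec (Branching j)
    branching? j = (K j Bool.≟ false) ×-dec
      any? λ u → any? λ v → ¬? (u ≟ v) ×-dec (E? G j u ×-dec E? G j v)

    ¬branching⇒pendant : ∀ {u z} → InI z → E G u z → ¬ Branching z → Pendant G u z
    ¬branching⇒pendant {u} {z} z∈I uz ¬branch = E-sym G uz , λ y zy →
      decidable-stable (y ≟ u) λ y≢u → ¬branch (z∈I , y , u , y≢u , zy , E-sym G uz)

    smallest-branching-balanced : ∀ {j} → Branching j → (∀ z → Branching z → degree j ≤ degree z) → IsBalanced G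
    smallest-branching-balanced {j} (j∈I , u , v , u≢v , ju , jv) min =
      [ id , paw ]′ (balanced-or-one-pendant ju jv u≢v)
      where
      dominates : ∀ {u v} → E G j u → E G j v → u ≢ v → Dominates v u
      dominates {u} {v} ju jv u≢v {z} z∈I uz with E? G v z
      ... | yes vz = inj₁ vz
      -- The neighbourhood of `z` meets that of `j` in `u` and misses `v`, so it lies strictly
      -- inside by laminarity; minimality of `j` then leaves `z` with a single neighbour.
      ... | no ¬vz = inj₂ (¬branching⇒pendant z∈I uz λ branch →
        <-irrefl refl (≤-trans
          (degree-mono-< (laminar j∈I z∈I ju (E-sym G uz) jv (¬vz ∘ E-sym G)) jv (¬vz ∘ E-sym G))
          (min z branch)))
      open Block (E G j) (E? G j) (I-neighbour j∈I) dominates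
      paw : OnePendant → IsBalanced G
      paw (k , l , jk , jl , k≢l , (i , i∈I , pend) , ¬pl , only) =
        Paw.balanced G pend jk jl (clique k l k≢l k∈K l∈K) (λ _ → only) same
        where
        k∈K = I-neighbour j∈I jk
        l∈K = I-neighbour j∈I jl
        same : ∀ z → z ≢ i → z ≢ j → z ≢ k → z ≢ l → adj G k z ≡ adj G l z
        same z z≢i _ z≢k z≢l with side z
        ... | inj₁ z∈K = adj-≡ (λ _ → clique l z (z≢l ∘ ≡-sym) l∈K z∈K) (λ _ → clique k z (z≢k ∘ ≡-sym) k∈K z∈K)
        ... | inj₂ z∈I = adj-≡
          (λ kz → [ id , (λ p → contradiction (pendant-unique p pend) z≢i) ]′ (dominates jk jl k≢l z∈I kz))
          (λ lz → [ id , (λ p → contradiction (z , z∈I , p) ¬pl) ]′ (dominates jl jk (k≢l ∘ ≡-sym) z∈I lz))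

    module NoBranching (¬branching : ∀ z → ¬ Branching z) where

      two-clique-vertices-balanced : ∀ {u v} → InK u → InK v → u ≢ v → IsBalanced G
      two-clique-vertices-balanced u∈K v∈K u≢v = [ id , ⊥-elim ∘ twins ]′ (balanced-or-one-pendant u∈K v∈K u≢v)
        where
        open Block InK (λ v → K v Bool.≟ true) id (λ _ _ _ z∈I uz → inj₂ (¬branching⇒pendant z∈I uz (¬branching _)))
        -- Here the clique is `k`, `l`, and an I-neighbour of `l` would be its pendant. So `k` is
        -- the only neighbour of `l`, as it is of `i`, and these two are twins.
        twins : ¬ OnePendant
        twins (k , l , k∈K , l∈K , k≢l , (i , i∈I , (ik , Ni)) , ¬pl , only) =
          twin-free (sides-differ l∈K i∈I ∘ ≡-sym) λ z z≢i z≢l →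
            (λ iz → subst (E G l) (≡-sym (Ni z iz)) (clique l k (k≢l ∘ ≡-sym) l∈K k∈K)) ,
            (λ lz → [ (λ z∈K → [ (λ { refl → ik }) , (λ z≡l → contradiction z≡l z≢l) ]′ (only z∈K))
                    , (λ z∈I → contradiction (z , z∈I , ¬branching⇒pendant z∈I lz (¬branching z)) ¬pl) ]′ (side z))

      module OneCliqueVertex (K-unique : ∀ {u v} → InK u → InK v → u ≡ v) where

        -- If `x` is the only neighbour of `k`, then `k` and `x` are twins; otherwise `x` and
        -- another neighbour of `k` are two leaves at `k`, again twins.
        no-edge : ∀ {k x} → InK k → InI x → ¬ E G k x
        no-edge {k} {x} k∈K x∈I kx with any? (λ z → ¬? (z ≟ x) ×-dec E? G k z)
        ... | no none = twin-free (E⇒≢ G kx) λ z z≢k z≢x →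
          (λ kz → contradiction (z , z≢x , kz) none) ,
          (λ xz → contradiction (K-unique (I-neighbour x∈I xz) k∈K) z≢k)
        ... | yes (z , z≢x , kz) = twin-free z≢x λ t _ _ → (λ zt → at-k x zt z∈I kx) , (λ xt → at-k z xt x∈I kz)
          where
          z∈I : InI z
          z∈I = [ (λ z∈K → contradiction (K-unique k∈K z∈K) (E⇒≢ G kz)) , id ]′ (side z)
          at-k : ∀ {y t} x → E G y t → InI y → E G k x → E G x t
          at-k x yt y∈I kx = subst (E G x) (K-unique k∈K (I-neighbour y∈I yt)) (E-sym G kx)

        edgeless : ∀ {u v} → ¬ E G u v
        edgeless {u} {v} uv with side u | side v
        ... | inj₁ u∈K | inj₁ v∈K = E⇒≢ G uv (K-unique u∈K v∈K)
        ... | inj₁ u∈K | inj₂ v∈I = no-edge u∈K v∈I uv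
        ... | inj₂ u∈I | inj₁ v∈K = no-edge v∈K u∈I (E-sym G uv)
        ... | inj₂ u∈I | inj₂ v∈I = independent u v u∈I v∈I uv

    balanced : ∀ {x y : Fin n} → x ≢ y → IsBalanced G
    balanced x≢y with any? branching?
    ... | yes branch = let _ , b , min = least branching? degree branch in smallest-branching-balanced b min
    ... | no none with any? (λ u → any? λ v → (K u Bool.≟ true) ×-dec ((K v Bool.≟ true) ×-dec ¬? (u ≟ v)))
    ...   | yes (u , v , u∈K , v∈K , u≢v) =
      NoBranching.two-clique-vertices-balanced (λ z b → none (z , b)) u∈K v∈K u≢v
    -- With at most one clique vertex and no branching, G has no edges, so the given `x` and `y`
    -- would be twins.
    ...   | no ¬two = ⊥-elim (twin-free x≢y λ _ _ _ → ⊥-elim ∘ edgeless , ⊥-elim ∘ edgeless)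
      where
      open NoBranching (λ z b → none (z , b))
      open OneCliqueVertex (λ {u} {v} u∈K v∈K → decidable-stable (u ≟ v) λ u≢v → ¬two (u , v , u∈K , v∈K , u≢v))

theorem9 : (n : ℕ) (G : Graph n) → IsSplit G → IsDistanceHereditary G →
    (HasIndistinguishablePair G ⊎ HalfSimplicial G) × IsBalanced G
theorem9 n G (K , clique , independent) dh with any? (λ x → any? (twins? G x))
... | yes (x , y , t) =
  inj₁ (x , y , proj₁ t , twins⇒indistinguishable G t) , twins⇒balanced G t
... | no none = inj₂ halfSimplicial , balance n G balanced
  where
  twin-free : ∀ {x y} → x ≢ y → ¬ (∀ z → z ≢ x → z ≢ y → (E G x z → E G y z) × (E G y z → E G x z))
  twin-free x≢y same = none (_ , _ , x≢y , λ z z≢x z≢y → uncurry (adj-≡ G) (same z z≢x z≢y))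
  open TwinFreeSplit G K clique independent dh twin-free
  balance : ∀ n (G : Graph n) → ({x y : Fin n} → x ≢ y → IsBalanced G) → IsBalanced G
  -- On at most one vertex, `numBasicWords` evaluates to 1 whatever the adjacency; from two vertices
  -- on, a pair of distinct vertices exists.
  balance zero          _ _    = inj₁ refl
  balance (suc zero)    _ _    = inj₁ refl
  balance (suc (suc _)) _ pair = pair {zero} {suc zero} λ ()
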